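{- There exist a $2$-$(765,9,2)$ design and a $2$-$(1845,9,2)$ design.
   Context: A $2$-$(v,k,\lambda)$ design is a pair $(V,\mathcal{A})$ where $V$ is a set of $v$ points and $\mathcal{A}$ is a collection (multiset) of $k$-subsets of $V$ (blocks) such that every $2$-subset of $V$ is contained in exactly $\lambda$ blocks of $\mathcal{A}$. -}

module Defs where

open import Data.Nat using (ℕ)
open import Data.Fin using (Fin)
open import Data.Fin.Subset using (Subset; _∈_; ∣_∣)
open import Data.Fin.Subset.Properties using (_∈?_)
open import Data.List using (List; length; filter)
open import Data.List.Relation.Unary.All using (All)
open import Data.Product using (_×_)
open import Relation.Nullary.Decidable using (_×-dec_)
open import Relation.Binary.PropositionalEquality using (_≡_; _≢_)

pairCount : ∀ {v} → Fin v → Fin v → List (Subset v) → ℕ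
pairCount x y blocks = length (filter (λ B → (x ∈? B) ×-dec (y ∈? B)) blocks)

-- A 2-(v,k,lam) design on the point set Fin v: a multiset (list) of blocks,
-- each a k-subset of Fin v, such that every 2-subset {x,y} (x ≢ y)
-- lies in exactly lam blocks.
record Design2 (v k lam : ℕ) : Set where
  field
    blocks    : List (Subset v)
    blockSize : All (λ B → ∣ B ∣ ≡ k) blocks
    balanced  : ∀ (x y : Fin v) → x ≢ y → pairCount x y blocks ≡ lam

{-# OPTIONS --safe #-}

-- The points are the residues modulo v = 45 q, for q = 17 and q = 41. The translates of a family of
-- base blocks cover twice every pair whose difference is not a multiple of q, and no other pair;
-- the remaining pairs lie inside the q cosets of the subgroup generated by q, and a copy of one
-- 2-(45,9,2) design on each coset covers them twice. Translation invariance reduces the first claim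
-- to counting, for each residue d, the representations of d as a difference inside a base block.
module Submission where

open import Defs
open import Data.Bool.Base using (Bool; true; false; if_then_else_; _∧_; _∨_)
open import Data.Bool.ListAction using (any)
open import Data.Bool.Properties using (∧-assoc; ∧-comm; ∧-zeroʳ)
open import Data.Fin.Base using (Fin; zero; suc; toℕ)
open import Data.Fin.Properties using (toℕ<n; toℕ-injective)
open import Data.Fin.Subset using (Subset; ∣_∣)
open import Data.Fin.Subset.Properties using (_∈?_)
open import Data.List.Base using (List; []; _∷_; _++_; applyUpTo; concatMap; iterate; length; map)
open import Data.List.Properties using (map-cong; map-cong-local)
open import Data.List.Relation.Unary.All as All using (All; []; _∷_)
import Data.List.Relation.Unary.All.Properties as All
open import Data.List.Relation.Unary.AllPairs using ([]; _∷_)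
open import Data.List.Relation.Unary.Unique.Propositional using (Unique)
open import Data.Nat.Base
open import Data.Nat.Divisibility using (_∣_; n∣m*n)
open import Data.Nat.DivMod
open import Data.Nat.ListAction using (sum)
open import Data.Nat.Properties
open import Data.Product.Base using (_×_; _,_)
open import Data.Vec.Base using ([]; _∷_; lookup; tabulate)
open import Data.Vec.Properties using (lookup∘tabulate)
open import Function.Base using (_∘_)
open import Relation.Binary.Definitions using (tri<; tri≈; tri>)
open import Relation.Binary.PropositionalEquality
open import Relation.Nullary using (Dec; does; contradiction; no; yes; _×-dec_)
open import Relation.Nullary.Decidable using (dec-false; dec-true; from-yes)
open import Algebra.Properties.CommutativeSemigroup +-commutativeSemigroup using (interchange)
open import Data.List.Relation.Unary.Unique.DecPropositional _≟_ using (unique?)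

open ≡-Reasoning

-- Boolean indicators and membership in lists of numbers.

bit : Bool → ℕ
bit b = if b then 1 else 0

mem : ℕ → List ℕ → Bool
mem z = any (z ≡ᵇ_)

≡ᵇ-true : ∀ {m n} → m ≡ n → (m ≡ᵇ n) ≡ true
≡ᵇ-true {m} {n} = dec-true (m ≟ n)

≡ᵇ-false : ∀ {m n} → m ≢ n → (m ≡ᵇ n) ≡ false
≡ᵇ-false {m} {n} = dec-false (m ≟ n)

≡ᵇ-comm : ∀ m n → (m ≡ᵇ n) ≡ (n ≡ᵇ m)
≡ᵇ-comm zero    zero    = refl
≡ᵇ-comm zero    (suc n) = refl
≡ᵇ-comm (suc m) zero    = refl
≡ᵇ-comm (suc m) (suc n) = ≡ᵇ-comm m n

mem-false : ∀ {z b} → All (z ≢_) b → mem z b ≡ false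
mem-false []         = refl
mem-false (z≢c ∷ ps) rewrite ≡ᵇ-false z≢c = mem-false ps

-- Finite sums over initial segments of the naturals.

Σ< : ℕ → (ℕ → ℕ) → ℕ
Σ< n f = sum (applyUpTo f n)

Σ<-cong : ∀ n {f g} → (∀ {i} → i < n → f i ≡ g i) → Σ< n f ≡ Σ< n g
Σ<-cong zero    eq = refl
Σ<-cong (suc n) eq = cong₂ _+_ (eq z<s) (Σ<-cong n (eq ∘ s<s))

Σ<-zero : ∀ n → Σ< n (λ _ → 0) ≡ 0
Σ<-zero zero    = refl
Σ<-zero (suc n) = Σ<-zero n

Σ<-+ : ∀ n (f g : ℕ → ℕ) → Σ< n (λ i → f i + g i) ≡ Σ< n f + Σ< n g
Σ<-+ zero    f g = refl
Σ<-+ (suc n) f g = trans (cong (f 0 + g 0 +_) (Σ<-+ n (f ∘ suc) (g ∘ suc)))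
                         (interchange (f 0) (g 0) _ _)

Σ<-last : ∀ n (f : ℕ → ℕ) → Σ< (suc n) f ≡ Σ< n f + f n
Σ<-last zero    f = +-comm (f 0) 0
Σ<-last (suc n) f = trans (cong (f 0 +_) (Σ<-last n (f ∘ suc))) (sym (+-assoc (f 0) _ _))

Σ<-split : ∀ m n (f : ℕ → ℕ) → Σ< (m + n) f ≡ Σ< m f + Σ< n (f ∘ (m +_))
Σ<-split zero    n f = refl
Σ<-split (suc m) n f = trans (cong (f 0 +_) (Σ<-split m n (f ∘ suc))) (sym (+-assoc (f 0) _ _))

Σ<-* : ∀ u q (f : ℕ → ℕ) → Σ< (u * q) f ≡ Σ< u (λ j → Σ< q (λ i → f (j * q + i)))
Σ<-* zero    q f = refl
Σ<-* (suc u) q f = begin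
  Σ< (q + u * q) f                                               ≡⟨ Σ<-split q (u * q) f ⟩
  Σ< q f + Σ< (u * q) (f ∘ (q +_))
    ≡⟨ cong (Σ< q f +_) (Σ<-* u q (f ∘ (q +_))) ⟩
  Σ< q f + Σ< u (λ j → Σ< q (λ i → f (q + (j * q + i))))
    ≡⟨ cong (Σ< q f +_) (Σ<-cong u λ {j} _ → Σ<-cong q λ {i} _ → cong f (+-assoc q (j * q) i)) ⟨
  Σ< q f + Σ< u (λ j → Σ< q (λ i → f (suc j * q + i)))           ∎

Σ<-single : ∀ {n c} (g : ℕ → Bool) → c < n → Σ< n (λ i → bit ((i ≡ᵇ c) ∧ g i)) ≡ bit (g c)
Σ<-single {suc n} {zero}  g c<n       = trans (cong (bit (g 0) +_) (Σ<-zero n)) (+-identityʳ _)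
Σ<-single {suc n} {suc c} g (s<s c<n) = Σ<-single (g ∘ suc) c<n

-- Translation permutes the residues. Raising `x` by one drops the term `g 0` and appends `g v`; the
-- two agree because adding `v` does not change a residue.
Σ<-shift : ∀ v .⦃ _ : NonZero v ⦄ x (f : ℕ → ℕ) → Σ< v (λ p → f ((x + p) % v)) ≡ Σ< v f
Σ<-shift v zero    f = Σ<-cong v (cong f ∘ m<n⇒m%n≡m)
Σ<-shift v (suc x) f = trans (+-cancelˡ-≡ (g 0) _ _ rotated) (Σ<-shift v x f)
  where
  g : ℕ → ℕ
  g p = f ((x + p) % v)

  rotated : g 0 + Σ< v (λ p → f ((suc x + p) % v)) ≡ g 0 + Σ< v g
  rotated = begin
    g 0 + Σ< v (λ p → f ((suc x + p) % v))
      -- `Σ< (suc v) g` unfolds to `g 0` plus the shifted terms; splitting off its last term instead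
      -- gives the other side.
      ≡⟨ cong (g 0 +_) (Σ<-cong v λ {p} _ → cong (λ e → f (e % v)) (+-suc x p)) ⟨
    Σ< (suc v) g                           ≡⟨ Σ<-last v g ⟩
    Σ< v g + g v                           ≡⟨ +-comm _ (g v) ⟩
    g v + Σ< v g
      ≡⟨ cong (λ e → f e + Σ< v g) (trans ([m+n]%n≡m%n x v) (cong (_% v) (sym (+-identityʳ x)))) ⟩
    g 0 + Σ< v g                           ∎

-- Blocks stay lists of numbers so that differences can be computed; `Unique` makes such a list
-- count as a set, of size its `length`.
Block : ℕ → List ℕ → Set
Block v b = Unique b × All (_< v) b

-- Distinct entries below `v` are each met exactly once as `z` runs over all residues. This turns a
-- count over the whole point set into one over the few entries of a block.
Σ<-mem : ∀ {v b} → Block v b → (g : ℕ → Bool) →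
         Σ< v (λ z → bit (mem z b ∧ g z)) ≡ sum (map (bit ∘ g) b)
Σ<-mem {v} {[]}    _                        g = Σ<-zero v
Σ<-mem {v} {c ∷ b} (c∉b ∷ u , c<v ∷ bnd) g = begin
  Σ< v (λ z → bit (((z ≡ᵇ c) ∨ mem z b) ∧ g z))
    ≡⟨ Σ<-cong v (λ {z} _ → split z) ⟩
  Σ< v (λ z → bit ((z ≡ᵇ c) ∧ g z) + bit (mem z b ∧ g z))            ≡⟨ Σ<-+ v _ _ ⟩
  Σ< v (λ z → bit ((z ≡ᵇ c) ∧ g z)) + Σ< v (λ z → bit (mem z b ∧ g z))
    ≡⟨ cong₂ _+_ (Σ<-single g c<v) (Σ<-mem (u , bnd) g) ⟩
  bit (g c) + sum (map (bit ∘ g) b)                                  ∎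
  where
  split : ∀ z → bit (((z ≡ᵇ c) ∨ mem z b) ∧ g z) ≡ bit ((z ≡ᵇ c) ∧ g z) + bit (mem z b ∧ g z)
  split z with z ≟ c
  ... | no z≢c rewrite ≡ᵇ-false z≢c = refl
  ... | yes refl rewrite ≡ᵇ-true {z} refl | mem-false c∉b = sym (+-identityʳ _)

Σ<-card : ∀ {v b} → Block v b → Σ< v (λ z → bit (mem z b)) ≡ length b
Σ<-card {v} {b} B = begin
  Σ< v (λ z → bit (mem z b))        ≡⟨ Σ<-cong v (λ {z} _ → cong bit (∧-comm true (mem z b))) ⟩
  Σ< v (λ z → bit (mem z b ∧ true)) ≡⟨ Σ<-mem B (λ _ → true) ⟩
  sum (map (λ _ → 1) b)             ≡⟨ ones b ⟩
  length b                          ∎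
  where
  ones : ∀ (b : List ℕ) → sum (map (λ _ → 1) b) ≡ length b
  ones []      = refl
  ones (_ ∷ b) = cong suc (ones b)

-- Subsets given by Boolean predicates, and pair counts of lists of them.

subset : ∀ {v} → (ℕ → Bool) → Subset v
subset P = tabulate (P ∘ toℕ)

∣subset∣ : ∀ v (P : ℕ → Bool) → ∣ subset {v} P ∣ ≡ Σ< v (bit ∘ P)
∣subset∣ zero    P = refl
∣subset∣ (suc v) P with P 0
... | true  = cong suc (∣subset∣ v (P ∘ suc))
... | false = ∣subset∣ v (P ∘ suc)

-- `filter` in `pairCount` looks only at the Boolean of the decision, so this lets pair counts be
-- computed from the defining predicate.
does-∈? : ∀ {v} (x : Fin v) (B : Subset v) → does (x ∈? B) ≡ lookup B x
does-∈? zero    (true  ∷ B) = refl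
does-∈? zero    (false ∷ B) = refl
does-∈? (suc x) (_     ∷ B) = does-∈? x B

module _ {v : ℕ} (x y : Fin v) where

  pairCount-∷ : ∀ (P : ℕ → Bool) bs →
    pairCount x y (subset P ∷ bs) ≡ bit (P (toℕ x) ∧ P (toℕ y)) + pairCount x y bs
  pairCount-∷ P bs
    rewrite does-∈? x (subset P) | does-∈? y (subset P)
          | lookup∘tabulate (P ∘ toℕ) x | lookup∘tabulate (P ∘ toℕ) y
    with P (toℕ x) ∧ P (toℕ y)
  ... | true  = refl
  ... | false = refl

  pairCount-++ : ∀ as bs → pairCount x y (as ++ bs) ≡ pairCount x y as + pairCount x y bs
  pairCount-++ []       bs = refl
  pairCount-++ (a ∷ as) bs with does (x ∈? a) ∧ does (y ∈? a)
  ... | true  = cong suc (pairCount-++ as bs)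
  ... | false = pairCount-++ as bs

  pairCount-concatMap : ∀ {A : Set} (F : A → List (Subset v)) as →
                        pairCount x y (concatMap F as) ≡ sum (map (pairCount x y ∘ F) as)
  pairCount-concatMap F []       = refl
  pairCount-concatMap F (a ∷ as) =
    trans (pairCount-++ (F a) _) (cong (_ +_) (pairCount-concatMap F as))

  pairCount-applyUpTo : ∀ (P : ℕ → ℕ → Bool) n →
    pairCount x y (applyUpTo (λ p → subset (P p)) n) ≡ Σ< n (λ p → bit (P p (toℕ x) ∧ P p (toℕ y)))
  pairCount-applyUpTo P zero    = refl
  pairCount-applyUpTo P (suc n) =
    trans (pairCount-∷ (P 0) _) (cong (_ +_) (pairCount-applyUpTo (P ∘ suc) n))

-- Difference counts of base blocks and pair counts of the small design.

diffCount : (v : ℕ) .⦃ _ : NonZero v ⦄ → List (List ℕ) → ℕ → ℕ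
diffCount v bs d = sum (map (λ b → sum (map (λ c → bit (mem ((c + d) % v) b)) b)) bs)

joinCount : List (List ℕ) → ℕ → ℕ → ℕ
joinCount bs i j = sum (map (λ b → bit (mem i b ∧ mem j b)) bs)

%-cong-+ : ∀ {a b} n .⦃ _ : NonZero n ⦄ c → a % n ≡ b % n → (a + c) % n ≡ (b + c) % n
%-cong-+ {a} {b} n c eq = begin
  (a + c) % n           ≡⟨ %-distribˡ-+ a c n ⟩
  (a % n + c % n) % n   ≡⟨ cong (λ e → (e + c % n) % n) eq ⟩
  (b % n + c % n) % n   ≡⟨ %-distribˡ-+ b c n ⟨
  (b + c) % n           ∎

joinCount-comm : ∀ bs i j → joinCount bs i j ≡ joinCount bs j i
joinCount-comm bs i j = cong sum (map-cong (λ b → cong bit (∧-comm (mem i b) (mem j b))) bs)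

-- The computed check covers only pairs with `j < i`; symmetry of the count supplies the others.
joinCount-≢ : ∀ {u lam bs} → (∀ {i} → i < u → ∀ {j} → j < i → joinCount bs i j ≡ lam) →
              ∀ {i j} → i < u → j < u → i ≢ j → joinCount bs i j ≡ lam
joinCount-≢ {bs = bs} join {i} {j} i<u j<u i≢j with <-cmp i j
... | tri< i<j _ _ = trans (joinCount-comm bs i j) (join j<u i<j)
... | tri≈ _ i≡j _ = contradiction i≡j i≢j
... | tri> _ _ j<i = join i<u j<i

sum-map-zero : ∀ {A : Set} {f : A → ℕ} → (∀ a → f a ≡ 0) → ∀ as → sum (map f as) ≡ 0
sum-map-zero f≡0 []       = refl
sum-map-zero f≡0 (a ∷ as) = cong₂ _+_ (f≡0 a) (sum-map-zero f≡0 as)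

-- The construction: translates of base blocks, with the cosets filled in.

module HoleFilling
  (u q k lam : ℕ) ⦃ _ : NonZero u ⦄ ⦃ _ : NonZero q ⦄
  (base hole : List (List ℕ))
  (baseBlocks : All (λ b → Block (u * q) b × length b ≡ k) base)
  (holeBlocks : All (λ b → Block u b × length b ≡ k) hole)
  where

  v : ℕ
  v = u * q

  instance
    v≢0 : NonZero v
    v≢0 = m*n≢0 u q

  module _
    -- Nonzero residues are enumerated as `suc d` with `d < pred v`, the form that `allUpTo?`
    -- decides.
    (diffs : ∀ {d} → d < pred v → diffCount v base (suc d) ≡ (if suc d % q ≡ᵇ 0 then 0 else lam))
    (joins : ∀ {i} → i < u → ∀ {j} → j < i → joinCount hole i j ≡ lam)
    where

    -- Testing `y + p` describes the translate of `b` by -p without subtraction; over all `p` these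
    -- are all the translates. For `coset`, `y % q` names the coset of `y` and `y / q` its label in
    -- the design on `u` points.
    translate coset : List ℕ → ℕ → ℕ → Bool
    translate b p y = mem ((y + p) % v) b
    coset     b i y = (i ≡ᵇ y % q) ∧ mem (y / q) b

    translates cosets : List ℕ → List (Subset v)
    translates b = applyUpTo (λ p → subset (translate b p)) v
    cosets     b = applyUpTo (λ i → subset (coset b i)) q

    ∣translate∣ : ∀ {b} → Block v b → ∀ p → ∣ subset {v} (translate b p) ∣ ≡ length b
    ∣translate∣ {b} B p = begin
      ∣ subset {v} (translate b p) ∣         ≡⟨ ∣subset∣ v (translate b p) ⟩
      Σ< v (λ y → bit (mem ((y + p) % v) b))
        ≡⟨ Σ<-cong v (λ {y} _ → cong (λ e → bit (mem (e % v) b)) (+-comm y p)) ⟩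
      Σ< v (λ y → bit (mem ((p + y) % v) b)) ≡⟨ Σ<-shift v p (λ z → bit (mem z b)) ⟩
      Σ< v (λ z → bit (mem z b))             ≡⟨ Σ<-card B ⟩
      length b                               ∎

    -- Cut the points into `u` rows of length `q`. Row `j` meets coset `i` in one point, which
    -- belongs to the block exactly when `j` is in `b`.
    ∣coset∣ : ∀ {b} → Block u b → ∀ {i} → i < q → ∣ subset {v} (coset b i) ∣ ≡ length b
    ∣coset∣ {b} B {i} i<q = begin
      ∣ subset {v} (coset b i) ∣                            ≡⟨ ∣subset∣ v (coset b i) ⟩
      Σ< (u * q) (bit ∘ coset b i)                          ≡⟨ Σ<-* u q (bit ∘ coset b i) ⟩
      Σ< u (λ j → Σ< q (λ h → bit (coset b i (j * q + h)))) ≡⟨ Σ<-cong u (λ {j} _ → row j) ⟩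
      Σ< u (λ j → bit (mem j b))                            ≡⟨ Σ<-card B ⟩
      length b                                              ∎
      where
      entry : ∀ j {h} → h < q → coset b i (j * q + h) ≡ (h ≡ᵇ i) ∧ mem j b
      entry j {h} h<q = cong₂ (λ r m → r ∧ mem m b) index quotient
        where
        rem : (j * q + h) % q ≡ h
        rem = trans (%-remove-+ˡ h (n∣m*n j)) (m<n⇒m%n≡m h<q)
        index : (i ≡ᵇ (j * q + h) % q) ≡ (h ≡ᵇ i)
        index rewrite rem = ≡ᵇ-comm i h
        quotient : (j * q + h) / q ≡ j
        quotient = begin
          (j * q + h) / q   ≡⟨ +-distrib-/-∣ˡ h (n∣m*n j) ⟩
          j * q / q + h / q ≡⟨ cong₂ _+_ (m*n/n≡m j q) (m<n⇒m/n≡0 h<q) ⟩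
          j + 0             ≡⟨ +-identityʳ j ⟩
          j                 ∎

      row : ∀ j → Σ< q (λ h → bit (coset b i (j * q + h))) ≡ bit (mem j b)
      row j = trans (Σ<-cong q (cong bit ∘ entry j)) (Σ<-single (λ _ → mem j b) i<q)

    blockSizes : All (λ B → ∣ B ∣ ≡ k) (concatMap translates base ++ concatMap cosets hole)
    blockSizes = All.++⁺
      (All.concat⁺ (All.map⁺ (All.map
        (λ (B , |b|) → All.applyUpTo⁺₂ _ v λ p → trans (∣translate∣ B p) |b|) baseBlocks)))
      (All.concat⁺ (All.map⁺ (All.map
        (λ (B , |b|) → All.applyUpTo⁺₁ _ q λ i<q → trans (∣coset∣ B i<q) |b|) holeBlocks)))

    -- Counting the blocks through two distinct points.

    module _ (x y : Fin v) (x≢y : x ≢ y) where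

      X Y e d : ℕ
      X = toℕ x
      Y = toℕ y
      -- `v ∸ X` stands for -X, so `d` is the residue of Y - X.
      e = Y + (v ∸ X)
      d = e % v

      X+e : ∀ p → (X + p) + e ≡ (Y + p) + v
      X+e p = begin
        (X + p) + (Y + (v ∸ X)) ≡⟨ cong (_+ e) (+-comm X p) ⟩
        (p + X) + (Y + (v ∸ X)) ≡⟨ interchange p X Y (v ∸ X) ⟩
        (p + Y) + (X + (v ∸ X)) ≡⟨ cong₂ _+_ (+-comm p Y) (m+[n∸m]≡n (<⇒≤ (toℕ<n x))) ⟩
        (Y + p) + v             ∎

      +d : ∀ p → ((X + p) % v + d) % v ≡ (Y + p) % v
      +d p = begin
        ((X + p) % v + d) % v ≡⟨ %-distribˡ-+ (X + p) e v ⟨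
        (X + p + e) % v       ≡⟨ cong (_% v) (X+e p) ⟩
        (Y + p + v) % v       ≡⟨ [m+n]%n≡m%n (Y + p) v ⟩
        (Y + p) % v           ∎

      X+d : (X + d) % v ≡ Y
      X+d = begin
        (X + d) % v
          ≡⟨ cong (λ h → (h + d) % v) (trans (cong (_% v) (+-identityʳ X)) (m<n⇒m%n≡m (toℕ<n x))) ⟨
        ((X + 0) % v + d) % v ≡⟨ +d 0 ⟩
        (Y + 0) % v           ≡⟨ cong (_% v) (+-identityʳ Y) ⟩
        Y % v                 ≡⟨ m<n⇒m%n≡m (toℕ<n y) ⟩
        Y                     ∎

      X≢Y : X ≢ Y
      X≢Y = x≢y ∘ toℕ-injective

      d≢0 : d ≢ 0
      d≢0 d≡0 = X≢Y (begin
        X           ≡⟨ m<n⇒m%n≡m (toℕ<n x) ⟨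
        X % v       ≡⟨ cong (_% v) (+-identityʳ X) ⟨
        (X + 0) % v ≡⟨ cong (λ h → (X + h) % v) d≡0 ⟨
        (X + d) % v ≡⟨ X+d ⟩
        Y           ∎)

      q∣v : q ∣ v
      q∣v = n∣m*n u

      -- As `q` divides `v`, reducing modulo `v` first does not affect the residue modulo `q`;
      -- replacing `Y` by `X` then turns `e` into `v`.
      sameCoset⇒q∣d : X % q ≡ Y % q → d % q ≡ 0
      sameCoset⇒q∣d eq = begin
        e % v % q         ≡⟨ m∣n⇒o%n%m≡o%m q v e q∣v ⟩
        (Y + (v ∸ X)) % q ≡⟨ %-cong-+ q (v ∸ X) (sym eq) ⟩
        (X + (v ∸ X)) % q ≡⟨ cong (_% q) (m+[n∸m]≡n (<⇒≤ (toℕ<n x))) ⟩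
        u * q % q         ≡⟨ m*n%n≡0 u q ⟩
        0                 ∎

      q∣d⇒sameCoset : d % q ≡ 0 → X % q ≡ Y % q
      q∣d⇒sameCoset eq = begin
        -- `m*n%n≡0 0 q` evaluates to `0 % q ≡ 0`, so `d` and 0 are congruent modulo `q`.
        X % q           ≡⟨ %-cong-+ q X (trans eq (sym (m*n%n≡0 0 q))) ⟨
        (d + X) % q     ≡⟨ cong (_% q) (+-comm d X) ⟩
        (X + d) % q     ≡⟨ m∣n⇒o%n%m≡o%m q v (X + d) q∣v ⟨
        (X + d) % v % q ≡⟨ cong (_% q) X+d ⟩
        Y % q           ∎

      translatesCount : pairCount x y (concatMap translates base) ≡ (if d % q ≡ᵇ 0 then 0 else lam)
      translatesCount = begin
        pairCount x y (concatMap translates base)   ≡⟨ pairCount-concatMap x y translates base ⟩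
        sum (map (pairCount x y ∘ translates) base)
          ≡⟨ cong sum (map-cong-local (All.map (λ (B , _) → perBlock B) baseBlocks)) ⟩
        diffCount v base d                          ≡⟨ diffs′ d≢0 (m%n<n e v) ⟩
        (if d % q ≡ᵇ 0 then 0 else lam)             ∎
        where
        perBlock : ∀ {b} → Block v b →
          pairCount x y (translates b) ≡ sum (map (λ c → bit (mem ((c + d) % v) b)) b)
        perBlock {b} B = begin
          pairCount x y (translates b)
            ≡⟨ pairCount-applyUpTo x y (translate b) v ⟩
          Σ< v (λ p → bit (mem ((X + p) % v) b ∧ mem ((Y + p) % v) b))
            -- Writing `Y + p` as `X + p + d` makes the summand depend on the single residue `z` of
            -- `X + p`, so the shift can be removed and only `d` remains.
            ≡⟨ Σ<-cong v (λ {p} _ → cong (λ h → bit (mem ((X + p) % v) b ∧ mem h b)) (+d p)) ⟨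
          Σ< v (λ p → bit (mem ((X + p) % v) b ∧ mem (((X + p) % v + d) % v) b))
            ≡⟨ Σ<-shift v X (λ z → bit (mem z b ∧ mem ((z + d) % v) b)) ⟩
          Σ< v (λ z → bit (mem z b ∧ mem ((z + d) % v) b))
            ≡⟨ Σ<-mem B (λ z → mem ((z + d) % v) b) ⟩
          sum (map (λ c → bit (mem ((c + d) % v) b)) b)                     ∎

        diffs′ : ∀ {d} → d ≢ 0 → d < v → diffCount v base d ≡ (if d % q ≡ᵇ 0 then 0 else lam)
        diffs′ {zero}  d≢0 _   = contradiction refl d≢0
        -- Here `suc d < v` has to become `d < pred v`.
        diffs′ {suc d} _   d<v = diffs (<⇒≤pred d<v)

      cosetsCount : pairCount x y (concatMap cosets hole) ≡
                    sum (map (λ b → bit (mem (X / q) b ∧ ((X % q ≡ᵇ Y % q) ∧ mem (Y / q) b))) hole)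
      cosetsCount = trans (pairCount-concatMap x y cosets hole) (cong sum (map-cong perBlock hole))
        where
        perBlock : ∀ b →
          pairCount x y (cosets b) ≡ bit (mem (X / q) b ∧ ((X % q ≡ᵇ Y % q) ∧ mem (Y / q) b))
        perBlock b = begin
          pairCount x y (cosets b)
            ≡⟨ pairCount-applyUpTo x y (coset b) q ⟩
          Σ< q (λ i → bit (((i ≡ᵇ X % q) ∧ mem (X / q) b) ∧ coset b i Y))
            ≡⟨ Σ<-cong q (λ {i} _ → cong bit (∧-assoc (i ≡ᵇ X % q) _ _)) ⟩
          Σ< q (λ i → bit ((i ≡ᵇ X % q) ∧ (mem (X / q) b ∧ coset b i Y)))
            -- Only the copy on the coset of `X` can contain `X`.
            ≡⟨ Σ<-single _ (m%n<n X q) ⟩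
          bit (mem (X / q) b ∧ coset b (X % q) Y)                             ∎

      quotients-≢ : X % q ≡ Y % q → X / q ≢ Y / q
      quotients-≢ eq eq′ = X≢Y (begin
        X                     ≡⟨ m≡m%n+[m/n]*n X q ⟩
        X % q + (X / q) * q   ≡⟨ cong₂ (λ r m → r + m * q) eq eq′ ⟩
        Y % q + (Y / q) * q   ≡⟨ m≡m%n+[m/n]*n Y q ⟨
        Y                     ∎)

      balance : pairCount x y (concatMap translates base ++ concatMap cosets hole) ≡ lam
      balance = trans (pairCount-++ x y (concatMap translates base) _)
                      (trans (cong₂ _+_ translatesCount cosetsCount) total)
        where
        total : (if d % q ≡ᵇ 0 then 0 else lam) +
                sum (map (λ b → bit (mem (X / q) b ∧ ((X % q ≡ᵇ Y % q) ∧ mem (Y / q) b))) hole) ≡ lam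
        total with X % q ≟ Y % q
        -- In one coset the translates contribute 0, and the labels of the two points are distinct,
        -- so the small design contributes `lam`.
        ... | yes eq rewrite ≡ᵇ-true eq | sameCoset⇒q∣d eq =
          joinCount-≢ {bs = hole} joins
            (m<n*o⇒m/o<n (toℕ<n x)) (m<n*o⇒m/o<n (toℕ<n y)) (quotients-≢ eq)
        -- In different cosets `d` is not a multiple of `q`, so the translates contribute `lam`, and
        -- every coset term carries a false factor.
        ... | no neq rewrite ≡ᵇ-false neq | ≡ᵇ-false (neq ∘ q∣d⇒sameCoset) =
          trans (cong (lam +_) (sum-map-zero (λ b → cong bit (∧-zeroʳ (mem (X / q) b))) hole))
                (+-identityʳ lam)

    design : Design2 v k lam
    design = record { blocks = _ ; blockSize = blockSizes ; balanced = balance }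

-- Decision procedures and the explicit block lists.

block? : ∀ v k b → Dec (Block v b × length b ≡ k)
block? v k b = (unique? b ×-dec All.all? (_<? v) b) ×-dec length b ≟ k

relativeDifferences? : ∀ v q lam .⦃ _ : NonZero v ⦄ .⦃ _ : NonZero q ⦄ bs →
  Dec (∀ {d} → d < pred v → diffCount v bs (suc d) ≡ (if suc d % q ≡ᵇ 0 then 0 else lam))
relativeDifferences? v q lam bs =
  allUpTo? (λ d → diffCount v bs (suc d) ≟ (if suc d % q ≡ᵇ 0 then 0 else lam)) (pred v)

joins? : ∀ u lam bs → Dec (∀ {i} → i < u → ∀ {j} → j < i → joinCount bs i j ≡ lam)
joins? u lam bs = allUpTo? (λ i → allUpTo? (λ j → joinCount bs i j ≟ lam) i) u

-- The residual of a 2-(56,11,2) biplane: delete one block of the biplane, and its points from the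
-- other blocks. The biplane consists of the closed neighbourhoods in the Gewirtz graph, which is
-- strongly regular with parameters (56,10,0,2).
residual45 : List (List ℕ)
residual45 =
  (0 ∷ 1 ∷ 5 ∷ 7 ∷ 10 ∷ 34 ∷ 35 ∷ 37 ∷ 43 ∷ []) ∷
  (0 ∷ 1 ∷ 18 ∷ 26 ∷ 28 ∷ 29 ∷ 33 ∷ 38 ∷ 39 ∷ []) ∷
  (0 ∷ 2 ∷ 3 ∷ 6 ∷ 11 ∷ 23 ∷ 25 ∷ 36 ∷ 39 ∷ []) ∷
  (0 ∷ 2 ∷ 7 ∷ 8 ∷ 9 ∷ 22 ∷ 27 ∷ 31 ∷ 33 ∷ []) ∷
  (0 ∷ 3 ∷ 4 ∷ 5 ∷ 9 ∷ 14 ∷ 15 ∷ 20 ∷ 30 ∷ []) ∷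
  (0 ∷ 4 ∷ 16 ∷ 26 ∷ 27 ∷ 37 ∷ 41 ∷ 42 ∷ 44 ∷ []) ∷
  (0 ∷ 6 ∷ 10 ∷ 19 ∷ 21 ∷ 28 ∷ 30 ∷ 40 ∷ 42 ∷ []) ∷
  (0 ∷ 8 ∷ 12 ∷ 13 ∷ 15 ∷ 16 ∷ 19 ∷ 25 ∷ 34 ∷ []) ∷
  (0 ∷ 11 ∷ 17 ∷ 24 ∷ 31 ∷ 38 ∷ 40 ∷ 43 ∷ 44 ∷ []) ∷
  (0 ∷ 12 ∷ 20 ∷ 21 ∷ 22 ∷ 24 ∷ 29 ∷ 32 ∷ 36 ∷ []) ∷
  (0 ∷ 13 ∷ 14 ∷ 17 ∷ 18 ∷ 23 ∷ 32 ∷ 35 ∷ 41 ∷ []) ∷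
  (1 ∷ 2 ∷ 12 ∷ 14 ∷ 19 ∷ 21 ∷ 31 ∷ 35 ∷ 44 ∷ []) ∷
  (1 ∷ 2 ∷ 16 ∷ 26 ∷ 30 ∷ 32 ∷ 34 ∷ 36 ∷ 40 ∷ []) ∷
  (1 ∷ 3 ∷ 6 ∷ 13 ∷ 22 ∷ 30 ∷ 33 ∷ 41 ∷ 44 ∷ []) ∷
  (1 ∷ 3 ∷ 8 ∷ 10 ∷ 12 ∷ 17 ∷ 23 ∷ 27 ∷ 28 ∷ []) ∷
  (1 ∷ 4 ∷ 7 ∷ 15 ∷ 17 ∷ 22 ∷ 25 ∷ 29 ∷ 40 ∷ []) ∷
  (1 ∷ 4 ∷ 8 ∷ 11 ∷ 19 ∷ 20 ∷ 32 ∷ 38 ∷ 41 ∷ []) ∷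
  (1 ∷ 5 ∷ 14 ∷ 18 ∷ 24 ∷ 25 ∷ 27 ∷ 36 ∷ 42 ∷ []) ∷
  (1 ∷ 6 ∷ 9 ∷ 16 ∷ 20 ∷ 23 ∷ 24 ∷ 31 ∷ 37 ∷ []) ∷
  (1 ∷ 9 ∷ 11 ∷ 13 ∷ 15 ∷ 21 ∷ 39 ∷ 42 ∷ 43 ∷ []) ∷
  (2 ∷ 3 ∷ 5 ∷ 7 ∷ 13 ∷ 19 ∷ 24 ∷ 26 ∷ 38 ∷ []) ∷
  (2 ∷ 4 ∷ 6 ∷ 12 ∷ 13 ∷ 18 ∷ 29 ∷ 37 ∷ 43 ∷ []) ∷
  (2 ∷ 4 ∷ 8 ∷ 17 ∷ 24 ∷ 30 ∷ 35 ∷ 39 ∷ 42 ∷ []) ∷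
  (2 ∷ 5 ∷ 9 ∷ 16 ∷ 17 ∷ 21 ∷ 28 ∷ 29 ∷ 41 ∷ []) ∷
  (2 ∷ 10 ∷ 14 ∷ 20 ∷ 25 ∷ 33 ∷ 40 ∷ 41 ∷ 43 ∷ []) ∷
  (2 ∷ 10 ∷ 15 ∷ 22 ∷ 23 ∷ 32 ∷ 37 ∷ 38 ∷ 42 ∷ []) ∷
  (2 ∷ 11 ∷ 15 ∷ 18 ∷ 20 ∷ 27 ∷ 28 ∷ 34 ∷ 44 ∷ []) ∷
  (3 ∷ 4 ∷ 10 ∷ 16 ∷ 18 ∷ 21 ∷ 25 ∷ 31 ∷ 38 ∷ []) ∷
  (3 ∷ 7 ∷ 9 ∷ 12 ∷ 18 ∷ 32 ∷ 40 ∷ 42 ∷ 44 ∷ []) ∷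
  (3 ∷ 8 ∷ 29 ∷ 31 ∷ 34 ∷ 36 ∷ 41 ∷ 42 ∷ 43 ∷ []) ∷
  (3 ∷ 11 ∷ 14 ∷ 17 ∷ 21 ∷ 22 ∷ 26 ∷ 34 ∷ 37 ∷ []) ∷
  (3 ∷ 15 ∷ 16 ∷ 24 ∷ 28 ∷ 32 ∷ 33 ∷ 35 ∷ 43 ∷ []) ∷
  (3 ∷ 19 ∷ 20 ∷ 27 ∷ 29 ∷ 35 ∷ 37 ∷ 39 ∷ 40 ∷ []) ∷
  (4 ∷ 5 ∷ 19 ∷ 22 ∷ 23 ∷ 28 ∷ 36 ∷ 43 ∷ 44 ∷ []) ∷
  (4 ∷ 6 ∷ 7 ∷ 14 ∷ 28 ∷ 31 ∷ 32 ∷ 34 ∷ 39 ∷ []) ∷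
  (4 ∷ 9 ∷ 10 ∷ 11 ∷ 12 ∷ 26 ∷ 33 ∷ 35 ∷ 36 ∷ []) ∷
  (4 ∷ 13 ∷ 21 ∷ 23 ∷ 24 ∷ 27 ∷ 33 ∷ 34 ∷ 40 ∷ []) ∷
  (5 ∷ 6 ∷ 8 ∷ 11 ∷ 16 ∷ 18 ∷ 22 ∷ 35 ∷ 40 ∷ []) ∷
  (5 ∷ 6 ∷ 12 ∷ 17 ∷ 20 ∷ 33 ∷ 34 ∷ 38 ∷ 42 ∷ []) ∷
  (5 ∷ 8 ∷ 21 ∷ 25 ∷ 32 ∷ 33 ∷ 37 ∷ 39 ∷ 44 ∷ []) ∷
  (5 ∷ 10 ∷ 11 ∷ 13 ∷ 27 ∷ 29 ∷ 30 ∷ 31 ∷ 32 ∷ []) ∷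
  (5 ∷ 12 ∷ 15 ∷ 23 ∷ 26 ∷ 31 ∷ 39 ∷ 40 ∷ 41 ∷ []) ∷
  (6 ∷ 7 ∷ 15 ∷ 21 ∷ 27 ∷ 35 ∷ 36 ∷ 38 ∷ 41 ∷ []) ∷
  (6 ∷ 8 ∷ 10 ∷ 14 ∷ 15 ∷ 24 ∷ 26 ∷ 29 ∷ 44 ∷ []) ∷
  (6 ∷ 9 ∷ 17 ∷ 19 ∷ 25 ∷ 26 ∷ 27 ∷ 32 ∷ 43 ∷ []) ∷
  (7 ∷ 8 ∷ 18 ∷ 20 ∷ 21 ∷ 23 ∷ 26 ∷ 30 ∷ 43 ∷ []) ∷
  (7 ∷ 10 ∷ 13 ∷ 16 ∷ 17 ∷ 20 ∷ 36 ∷ 39 ∷ 44 ∷ []) ∷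
  (7 ∷ 11 ∷ 12 ∷ 24 ∷ 25 ∷ 28 ∷ 30 ∷ 37 ∷ 41 ∷ []) ∷
  (7 ∷ 11 ∷ 14 ∷ 16 ∷ 19 ∷ 23 ∷ 29 ∷ 33 ∷ 42 ∷ []) ∷
  (8 ∷ 9 ∷ 13 ∷ 14 ∷ 28 ∷ 36 ∷ 37 ∷ 38 ∷ 40 ∷ []) ∷
  (9 ∷ 10 ∷ 18 ∷ 19 ∷ 22 ∷ 24 ∷ 34 ∷ 39 ∷ 41 ∷ []) ∷
  (9 ∷ 23 ∷ 25 ∷ 29 ∷ 30 ∷ 34 ∷ 35 ∷ 38 ∷ 44 ∷ []) ∷
  (12 ∷ 14 ∷ 16 ∷ 22 ∷ 27 ∷ 30 ∷ 38 ∷ 39 ∷ 43 ∷ []) ∷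
  (13 ∷ 20 ∷ 22 ∷ 25 ∷ 26 ∷ 28 ∷ 31 ∷ 35 ∷ 42 ∷ []) ∷
  (15 ∷ 17 ∷ 18 ∷ 19 ∷ 30 ∷ 31 ∷ 33 ∷ 36 ∷ 37 ∷ []) ∷
  []

-- Proved by evaluation: `from-yes` type checks only if the decision procedure computes to `yes`.
-- The other facts about the explicit lists are obtained in the same way.
residual45-blocks : All (λ b → Block 45 b × length b ≡ 9) residual45
residual45-blocks = from-yes (All.all? (block? 45 9) residual45)

residual45-joins : ∀ {i} → i < 45 → ∀ {j} → j < i → joinCount residual45 i j ≡ 2
residual45-joins = from-yes (joins? 45 2 residual45)

-- Dilation by a unit `m` sends representations of a difference `d` to representations of `d * m`. A
-- family closed under it has difference counts constant on the orbits of `m`, which reduces a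
-- search to a few starter blocks.
dilates : (v m n : ℕ) .⦃ _ : NonZero v ⦄ → List ℕ → List (List ℕ)
dilates v m n b = iterate (map (λ c → (c * m) % v)) b n

-- The multiplier m is 19 modulo 45 and generates the squares modulo q, so it has order (q − 1) / 2.
-- Its power of exponent (q − 1) / 4 is 1 modulo 45 and −1 modulo q, and fixes the first starter
-- block, which therefore has only half as many dilates. The starter blocks were found by computer.
base765 : List (List ℕ)
base765 =
  dilates 765 604 4 (0 ∷ 108 ∷ 198 ∷ 256 ∷ 479 ∷ 485 ∷ 524 ∷ 526 ∷ 620 ∷ []) ++
  dilates 765 604 8 (0 ∷ 18 ∷ 130 ∷ 134 ∷ 203 ∷ 223 ∷ 235 ∷ 549 ∷ 758 ∷ []) ++
  dilates 765 604 8 (0 ∷ 37 ∷ 106 ∷ 109 ∷ 193 ∷ 206 ∷ 269 ∷ 277 ∷ 589 ∷ [])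

base1845 : List (List ℕ)
base1845 =
  dilates 1845 1594 10 (0 ∷ 227 ∷ 479 ∷ 698 ∷ 1132 ∷ 1492 ∷ 1577 ∷ 1598 ∷ 1694 ∷ []) ++
  dilates 1845 1594 20 (0 ∷ 637 ∷ 721 ∷ 819 ∷ 871 ∷ 1104 ∷ 1354 ∷ 1607 ∷ 1797 ∷ []) ++
  dilates 1845 1594 20 (0 ∷ 566 ∷ 837 ∷ 880 ∷ 1121 ∷ 1477 ∷ 1581 ∷ 1603 ∷ 1662 ∷ [])

base765-blocks : All (λ b → Block 765 b × length b ≡ 9) base765
base765-blocks = from-yes (All.all? (block? 765 9) base765)

-- The 20 blocks have 20 · 72 = 1440 ordered differences, twice the number 765 - 45 = 720 of
-- residues that are not multiples of 17; evaluation confirms that they are spread evenly.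
base765-diffs : ∀ {d} → d < 764 → diffCount 765 base765 (suc d) ≡ (if suc d % 17 ≡ᵇ 0 then 0 else 2)
base765-diffs = from-yes (relativeDifferences? 765 17 2 base765)

base1845-blocks : All (λ b → Block 1845 b × length b ≡ 9) base1845
base1845-blocks = from-yes (All.all? (block? 1845 9) base1845)

-- The totals again agree: 50 · 72 = 3600 = 2 · (1845 - 45).
base1845-diffs : ∀ {d} → d < 1844 → diffCount 1845 base1845 (suc d) ≡
                 (if suc d % 41 ≡ᵇ 0 then 0 else 2)
base1845-diffs = from-yes (relativeDifferences? 1845 41 2 base1845)

theorem2p13 : Design2 765 9 2 × Design2 1845 9 2
theorem2p13 =
  -- `45 * 17` evaluates to 765 and `45 * 41` to 1845, so the checked facts fit as they stand; one
  -- small design fills the cosets in both cases.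
  design 45 17 9 2 base765 residual45
    base765-blocks residual45-blocks base765-diffs residual45-joins ,
  design 45 41 9 2 base1845 residual45
    base1845-blocks residual45-blocks base1845-diffs residual45-joins
  where open HoleFilling
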